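{- Let $k\ge 2$ be an integer, let $n_1,n_2,\ldots,n_k\in\mathbb{N}$ satisfy $n_1\le n_2\le\cdots\le n_k$, and let $G=K_{n_1,n_2,\ldots,n_k}$ be the complete $k$-partite graph with partite sets of sizes $n_1,\ldots,n_k$. Then the list flexibility number of $G$ satisfies $\chi_{\ell flex}(G)\le n_1+\cdots+n_{k-1}+1$.
   Context: All graphs are nonempty, finite and simple; $\mathbb{N}=\{1,2,3,\ldots\}$. A list assignment $L$ for a graph $G$ assigns to each vertex $v$ a set $L(v)$ of colors; it is a $k$-assignment if $|L(v)|=k$ for every $v\in V(G)$. A proper $L$-coloring of $G$ is a proper coloring $f$ of $G$ with $f(v)\in L(v)$ for every $v\in V(G)$. A request of $L$ is a function $r$ with nonempty domain $D\subseteq V(G)$ such that $r(v)\in L(v)$ for each $v\in D$. For $\epsilon\in[0,1]$, the triple $(G,L,r)$ is $\epsilon$-satisfiable if there is a proper $L$-coloring $f$ of $G$ with $f(v)=r(v)$ for at least $\epsilon|D|$ vertices $v\in D$. The graph $G$ is $(k,\epsilon)$-flexible if $(G,L,r)$ is $\epsilon$-satisfiable for every $k$-assignment $L$ for $G$ and every request $r$ of $L$. The Hall ratio of $G$ is $\rho(G)=\max_{\emptyset\ne H\subseteq G}|V(H)|/\alpha(H)$, the maximum over nonempty subgraphs $H$ of $G$, where $\alpha(H)$ is the independence number. The list flexibility number $\chi_{\ell flex}(G)$ is the smallest $k$ such that $G$ is $(k,1/\rho(G))$-flexible (such a $k$ exists for every graph $G$). -}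

module Defs where

open import Level using (0ℓ; _⊔_) renaming (suc to lsuc)
open import Data.Fin.Base as Fin using (Fin; zero; suc; splitAt)
import Data.Fin.Properties as Fin
open import Data.Fin.Subset using (Subset; _∈_; _⊆_; Nonempty; ∣_∣)
open import Data.Integer.Base using (+_)
open import Data.List.Base using (List; length)
import Data.List.Membership.Propositional as List
open import Data.List.Relation.Unary.Unique.Propositional using (Unique)
open import Data.Maybe.Base using (Maybe; just; is-just)
import Data.Maybe.Properties as Maybe
open import Data.Nat.Base using (ℕ; zero; suc; _≤_; _<_)
import Data.Nat.Properties as ℕ
open import Data.Product.Base using (Σ-syntax; ∃-syntax; _×_; _,_)
open import Data.Rational.Base as ℚ using (ℚ; _/_; 1/_)
open import Data.Sum.Base using ([_,_]′)
open import Data.Vec.Base using (Vec; []; _∷_; lookup; sum; tabulate)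
open import Function.Base using (_∘_; const; flip)
open import Relation.Binary.Core using (Rel)
open import Relation.Binary.Definitions using (Decidable; Symmetric)
open import Relation.Binary.PropositionalEquality using (_≡_; _≢_; refl; ≢-sym)
open import Relation.Nullary using (¬_; does; ¬?)
open import Relation.Unary using (Pred)

IsGreatest : ∀ {a p r} {A : Set a} → Rel A r → Pred A p → Pred A (a ⊔ p ⊔ r)
IsGreatest _≼_ P m = P m × (∀ x → P x → x ≼ m)

IsLeast : ∀ {a p r} {A : Set a} → Rel A r → Pred A p → Pred A (a ⊔ p ⊔ r)
IsLeast _≼_ = IsGreatest (flip _≼_)

record Graph : Set₁ where
  infix 4 _~_ _~?_
  field
    order    : ℕ
    nonempty : 0 < order

  Vertex : Set
  Vertex = Fin order

  field
    _~_      : Rel Vertex 0ℓ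
    _~?_     : Decidable _~_
    ~-sym    : Symmetric _~_
    ~-irrefl : ∀ {v} → ¬ (v ~ v)

record Subgraph (G : Graph) : Set₁ where
  open Graph G using (order; Vertex; _~_)
  infix 4 _~ₕ_ _~ₕ?_
  field
    vertices : Subset order
    nonempty : Nonempty vertices
    _~ₕ_      : Rel Vertex 0ℓ
    _~ₕ?_     : Decidable _~ₕ_
    ~ₕ-sym    : Symmetric _~ₕ_
    ~ₕ⇒~      : ∀ {u v} → u ~ₕ v → u ~ v
    ~ₕ⇒∈      : ∀ {u v} → u ~ₕ v → u ∈ vertices × v ∈ vertices

module _ {G : Graph} (H : Subgraph G) where
  open Graph G using (order)
  open Subgraph H

  Independent : Pred (Subset order) 0ℓ
  Independent S = S ⊆ vertices × (∀ {u v} → u ∈ S → v ∈ S → ¬ (u ~ₕ v))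

  IsIndependenceNumber : Pred ℕ 0ℓ
  IsIndependenceNumber = IsGreatest _≤_ λ a → ∃[ S ] (Independent S × ∣ S ∣ ≡ a)

-- The independence number of a nonempty subgraph is positive, hence suc a.
HallQuotient : Graph → Pred ℚ (lsuc 0ℓ)
HallQuotient G q =
  Σ[ H ∈ Subgraph G ] ∃[ a ]
    (IsIndependenceNumber H (suc a) × q ≡ + ∣ Subgraph.vertices H ∣ / suc a)

IsHallRatio : Graph → Pred ℚ (lsuc 0ℓ)
IsHallRatio G = IsGreatest ℚ._≤_ (HallQuotient G)

Color : Set
Color = ℕ

module _ (G : Graph) where
  open Graph G using (order; Vertex; _~_)

  ListAssignment : Set
  ListAssignment = Vertex → List Color

  -- Finite sets of colors are represented by lists without repetition.
  IsAssignment : ℕ → Pred ListAssignment 0ℓ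
  IsAssignment k L = ∀ v → Unique (L v) × length (L v) ≡ k

  IsProperListColoring : ListAssignment → Pred (Vertex → Color) 0ℓ
  IsProperListColoring L f =
    (∀ {u v} → u ~ v → f u ≢ f v) × (∀ v → f v List.∈ L v)

  PartialColoring : Set
  PartialColoring = Vertex → Maybe Color

  domain : PartialColoring → Subset order
  domain r = tabulate λ v → is-just (r v)

  IsRequest : ListAssignment → Pred PartialColoring 0ℓ
  IsRequest L r = Nonempty (domain r) × (∀ {v c} → r v ≡ just c → c List.∈ L v)

  -- { v ∈ domain r | f v = r v }
  satisfied : PartialColoring → (Vertex → Color) → Subset order
  satisfied r f = tabulate λ v → does (Maybe.≡-dec ℕ._≟_ (r v) (just (f v)))

  Satisfiable : ListAssignment → PartialColoring → ℚ → Set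
  Satisfiable L r ε =
    ∃[ f ] (IsProperListColoring L f ×
            ε ℚ.* (+ ∣ domain r ∣ / 1) ℚ.≤ + ∣ satisfied r f ∣ / 1)

  Flexible : ℕ → ℚ → Set
  Flexible k ε =
    ∀ L → IsAssignment k L → ∀ r → IsRequest L r → Satisfiable L r ε

  -- The condition 1 ≤ k matters: a 0-assignment admits no request, so every
  -- graph is vacuously (0 , ε)-flexible.
  IsListFlexibilityNumber : Pred ℕ (lsuc 0ℓ)
  IsListFlexibilityNumber m =
    Σ[ ρ ∈ ℚ ] Σ[ ρ≢0 ∈ ℚ.NonZero ρ ]
      (IsHallRatio G ρ ×
       IsLeast _≤_ (λ k → 1 ≤ k × Flexible k ((1/ ρ) {{ρ≢0}})) m)

-- The vertices are laid out block by block, the i-th block having lookup ns i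
-- elements; part returns the block of a vertex.
part : ∀ {k} (ns : Vec ℕ k) → Fin (sum ns) → Fin k
part (n ∷ ns) v = [ const zero , suc ∘ part ns ]′ (splitAt n v)

completeMultipartite : ∀ {k} (ns : Vec ℕ (suc k)) →
                       (∀ i → 1 ≤ lookup ns i) → Graph
completeMultipartite ns@(_ ∷ _) pos = record
  { order    = sum ns
  ; nonempty = ℕ.≤-trans (pos zero) (ℕ.m≤m+n _ _)
  ; _~_      = λ u v → part ns u ≢ part ns v
  ; _~?_     = λ u v → ¬? (part ns u Fin.≟ part ns v)
  ; ~-sym    = ≢-sym
  ; ~-irrefl = λ v≁v → v≁v refl
  }

-- The Hall ratio of a complete k-partite graph is k: a subgraph meets each part
-- in an independent set, and a transversal is a clique.
--
-- With lists of more than n₁ + ⋯ + nₖ₋₁ colours, 1/k of any request can be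
-- granted, by induction on k.  Each vertex of the smallest part V₁ has more than
-- (k - 1) n₁ colours, so V₁ has k colourings with pairwise disjoint sets of
-- colours, the first of which grants all requests on V₁.  Fix V₁ by one of them,
-- delete its colours from the other lists, and apply induction to the requests
-- that survive.  If the t-th colouring grants s_t requests on V₁ and lets κ_t
-- others survive, it yields at least s_t + κ_t / (k - 1) granted requests.  Every
-- request outside V₁ is destroyed by at most one of the k colourings, so
-- Σ_t ((k - 1) s_t + κ_t) is at least (k - 1) times the number of requests, and
-- some t reaches the average.
--
-- That a least k exists needs flexibility to be decidable; up to an injective
-- renaming of the colours there are only finitely many list assignments.

module Submission where

open import Defs
open import Data.Bool.Base using (Bool; true; false; if_then_else_; _∧_)
open import Data.Fin.Base as Fin using (Fin; zero; suc; toℕ; _↑ˡ_; _↑ʳ_; splitAt)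
import Data.Fin.Properties as Fin
open import Data.Fin.Subset as Subset using (Subset; Nonempty; ⁅_⁆; ∣_∣)
import Data.Fin.Subset.Properties as Subset
open import Data.Integer.Base as ℤ using (+_)
import Data.Integer.Properties as ℤ
open import Data.List.Base as List using (List; []; _∷_; _++_; length; filter)
import Data.List.Properties as List
import Data.List.Membership.Setoid.Properties as Membershipₛ
open import Data.List.Membership.Propositional using (_∈_; _∉_; find; lose)
open import Data.List.Membership.Propositional.Properties
open import Data.List.Relation.Unary.All as All using ([]; _∷_)
open import Data.List.Relation.Unary.AllPairs using ([]; _∷_)
open import Data.List.Relation.Unary.Any as Any using (Any; here; there; any?)
open import Data.List.Relation.Unary.Unique.Propositional using (Unique)
import Data.List.Relation.Unary.Unique.Propositional.Properties as Unique
open import Data.Maybe.Base as Maybe using (Maybe; just; nothing; is-just)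
import Data.Maybe.Properties as Maybe
open import Data.Nat.Base
open import Data.Nat.Induction using (<-rec)
open import Data.Nat.Properties
open import Data.Nat.Tactic.RingSolver using (solve-∀)
open import Data.Product.Base using (∃-syntax; _×_; _,_; proj₁; proj₂)
open import Data.Rational.Base as ℚ using (ℚ; 1/_)
import Data.Rational.Properties as ℚ
open import Data.Rational.Unnormalised.Base as ℚᵘ using (mkℚᵘ)
import Data.Rational.Unnormalised.Properties as ℚᵘ
open import Data.Sum.Base using (inj₁; inj₂; [_,_]′)
open import Data.Vec.Base as Vec using (Vec; []; _∷_; lookup; tabulate; sum; init)
import Data.Vec.Properties as Vec
open import Function.Base using (_∘_; const)
open import Function.Bundles using (mk⇔)
open import Relation.Binary.PropositionalEquality
open import Relation.Nullary using (¬_; Dec; yes; no; does; ¬?; contradiction)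
open import Relation.Nullary.Decidable using (dec-true; does-⇔; map′; _×-dec_; _→-dec_; decidable-stable)
open import Relation.Unary using (Decidable)

open import Algebra.Properties.Semiring.Sum +-*-semiring
  using (sum-syntax; ∑-comm; ∑-distrib-+; *-distribˡ-sum; sum-cong-≗) renaming (sum to ∑)
open import Data.List.Membership.DecPropositional _≟_ using (_∈?_)
open import Data.List.Relation.Unary.Unique.DecPropositional _≟_ using (unique?)

private variable
  k m n : ℕ

-- Finite sums, averages and counting by Boolean indicators.

∑-mono-≤ : {f g : Fin n → ℕ} → (∀ i → f i ≤ g i) → ∑ f ≤ ∑ g
∑-mono-≤ {zero}  f≤g = z≤n
∑-mono-≤ {suc n} f≤g = +-mono-≤ (f≤g zero) (∑-mono-≤ (f≤g ∘ suc))

∑-const : ∀ n c → ∑ {n} (const c) ≡ n * c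
∑-const zero    c = refl
∑-const (suc n) c = cong₂ _+_ refl (∑-const n c)

∑-splitAt : ∀ m (f : Fin (m + n) → ℕ) → ∑ f ≡ ∑ (f ∘ (_↑ˡ n)) + ∑ (f ∘ (m ↑ʳ_))
∑-splitAt zero    f = refl
∑-splitAt (suc m) f = trans (cong₂ _+_ refl (∑-splitAt m (f ∘ suc))) (sym (+-assoc (f zero) _ _))

f[i]≤∑f : ∀ (f : Fin n → ℕ) i → f i ≤ ∑ f
f[i]≤∑f f zero    = m≤m+n _ _
f[i]≤∑f f (suc i) = ≤-trans (f[i]≤∑f (f ∘ suc) i) (m≤n+m _ _)

-- The average is compared multiplicatively, so no division occurs. If the head falls short of it,
-- the entry found for the tail dominates the head and works for the whole sum.
averaging : ∀ {N} (f : Fin (suc n) → ℕ) → N ≤ ∑ f → ∃[ i ] N ≤ suc n * f i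
averaging {zero}  f N≤∑ = zero , N≤∑
averaging {suc n} {N} f N≤∑ with N ≤? (2 + n) * f zero
... | yes N≤ = zero , N≤
... | no  N≰ with averaging {N = ∑ (f ∘ suc)} (f ∘ suc) ≤-refl
...   | i , ∑≤ = suc i , ≤-trans N≤∑ (+-mono-≤ f₀≤fᵢ ∑≤)
  where
  open ≤-Reasoning
  f₀≤fᵢ : f zero ≤ f (suc i)
  -- One copy of `f zero` cancels on both sides, leaving `suc n` copies of it against `suc n` copies
  -- of `f (suc i)`.
  f₀≤fᵢ = *-cancelˡ-≤ (suc n) (+-cancelˡ-≤ (f zero) _ _ (begin
    (2 + n) * f zero            ≤⟨ ≰⇒≥ N≰ ⟩
    N                           ≤⟨ N≤∑ ⟩
    f zero + ∑ (f ∘ suc)        ≤⟨ +-monoʳ-≤ (f zero) ∑≤ ⟩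
    f zero + suc n * f (suc i)  ∎))

𝟙 : Bool → ℕ
𝟙 b = if b then 1 else 0

# : (Fin n → Bool) → ℕ
# b = ∑ (𝟙 ∘ b)

𝟙-mono : ∀ {b c} → (b ≡ true → c ≡ true) → 𝟙 b ≤ 𝟙 c
𝟙-mono {false}     b⇒c = z≤n
𝟙-mono {true}  {c} b⇒c rewrite b⇒c refl = ≤-refl

#-mono : {b c : Fin n → Bool} → (∀ i → b i ≡ true → c i ≡ true) → # b ≤ # c
#-mono b⇒c = ∑-mono-≤ (λ i → 𝟙-mono (b⇒c i))

∣tabulate∣ : (b : Fin n → Bool) → ∣ tabulate b ∣ ≡ # b
∣tabulate∣ {zero}  b = refl
∣tabulate∣ {suc n} b with b zero
... | true  = cong suc (∣tabulate∣ (b ∘ suc))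
... | false = ∣tabulate∣ (b ∘ suc)

#-all : (b : Fin n → Bool) → (∀ i → b i ≡ true) → n ≤ # b
#-all {zero}  b all = z≤n
#-all {suc n} b all rewrite all zero = s≤s (#-all (b ∘ suc) (all ∘ suc))

-- The hypothesis says that no two distinct indices are both false, so once the head is false the
-- whole tail is true.
#-all-but-one : (b : Fin (suc n) → Bool) →
                (∀ {i j} → i ≢ j → b i ≡ false → b j ≡ true) → n ≤ # b
#-all-but-one {zero}  b uniq = z≤n
#-all-but-one {suc n} b uniq with b zero in eq
... | true  = s≤s (#-all-but-one (b ∘ suc) (λ i≢j → uniq (i≢j ∘ Fin.suc-injective)))
... | false = #-all (b ∘ suc) (λ i → uniq (λ ()) eq)

does⁻ : ∀ {P : Set} (P? : Dec P) → does P? ≡ true → P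
does⁻ (yes p) _ = p

-- Greedy choice of colours

≢? : ∀ (y x : Color) → Dec (x ≢ y)
≢? y x = ¬? (x ≟ y)

infixl 6 _∖_
_∖_ : List Color → List Color → List Color
xs ∖ []       = xs
xs ∖ (y ∷ ys) = filter (≢? y) (xs ∖ ys)

∈-∖⁺ : ∀ {x xs} ys → x ∈ xs → x ∉ ys → x ∈ xs ∖ ys
∈-∖⁺ []       x∈xs x∉ys = x∈xs
∈-∖⁺ (y ∷ ys) x∈xs x∉ys =
  ∈-filter⁺ (≢? y) (∈-∖⁺ ys x∈xs (x∉ys ∘ there)) (x∉ys ∘ here)

∈-∖⁻ : ∀ {x xs} ys → x ∈ xs ∖ ys → x ∈ xs × x ∉ ys
∈-∖⁻ []       x∈ = x∈ , λ ()
∈-∖⁻ (y ∷ ys) x∈ with ∈-filter⁻ (≢? y) x∈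
... | x∈′ , x≢y with ∈-∖⁻ ys x∈′
...   | x∈xs , x∉ys = x∈xs , λ { (here x≡y) → x≢y x≡y ; (there x∈ys) → x∉ys x∈ys }

∖-unique : ∀ {xs} ys → Unique xs → Unique (xs ∖ ys)
∖-unique []       u = u
∖-unique (y ∷ ys) u = Unique.filter⁺ (≢? y) (∖-unique ys u)

-- Uniqueness allows at most one occurrence of `y`; if it is the head, the filter keeps the whole
-- tail.
length-filter-≢ : ∀ y {xs} → Unique xs → length xs ≤ suc (length (filter (≢? y) xs))
length-filter-≢ y []                 = z≤n
length-filter-≢ y {x ∷ xs} (x∉ ∷ u) with x ≟ y
... | yes refl = s≤s (≤-reflexive (cong length (sym (begin
  filter (≢? x) (x ∷ xs) ≡⟨ List.filter-reject (≢? x) (λ x≢x → x≢x refl) ⟩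
  filter (≢? x) xs       ≡⟨ List.filter-all (≢? x) (All.map ≢-sym x∉) ⟩
  xs                     ∎))))
  where open ≡-Reasoning
... | no  x≢y  rewrite List.filter-accept (≢? y) {xs = xs} x≢y = s≤s (length-filter-≢ y u)

length-∖ : ∀ {xs} ys → Unique xs → length xs ≤ length ys + length (xs ∖ ys)
length-∖ []       u = ≤-refl
length-∖ {xs} (y ∷ ys) u = begin
  length xs                                ≤⟨ length-∖ ys u ⟩
  length ys + length (xs ∖ ys)             ≤⟨ +-monoʳ-≤ (length ys) (length-filter-≢ y (∖-unique ys u)) ⟩
  length ys + suc (length (xs ∖ (y ∷ ys))) ≡⟨ +-suc (length ys) _ ⟩
  length (y ∷ ys) + length (xs ∖ (y ∷ ys)) ∎
  where open ≤-Reasoning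

pick : ∀ {xs : List Color} → 0 < length xs → ∃[ x ] x ∈ xs
pick {xs = x ∷ _} _ = x , here refl

avoid : ∀ {xs} ys → Unique xs → length ys < length xs → ∃[ x ] (x ∈ xs × x ∉ ys)
avoid {xs} ys u ys<xs = let x , x∈ = pick nonempty in x , ∈-∖⁻ ys x∈
  where
  open ≤-Reasoning
  nonempty : 0 < length (xs ∖ ys)
  nonempty = +-cancelˡ-< (length ys) _ _ (begin-strict
    length ys + 0                ≡⟨ +-identityʳ _ ⟩
    length ys                    <⟨ ys<xs ⟩
    length xs                    ≤⟨ length-∖ ys u ⟩
    length ys + length (xs ∖ ys) ∎)

Disjoint : (Fin k → Fin n → Color) → Set
Disjoint fs = ∀ {s t} → s ≢ t → ∀ u v → fs s u ≢ fs t v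

-- `R` collects the colours already spent. Only disjointness between different colourings is asked
-- for: within one part there are no edges, so a single colouring may repeat colours. Each colouring
-- thus forbids at most `n` colours to the later ones, and `k * n` pays for `k` more.
extendDisjoint : ∀ {k} (L : Fin n → List Color) (f : Fin n → Color) R →
  (∀ v → Unique (L v)) → (∀ v → length R + k * n < length (L v)) →
  (∀ v → f v ∈ L v × f v ∉ R) →
  ∃[ fs ] (fs zero ≡ f × (∀ t v → fs t v ∈ L v × fs t v ∉ R) × Disjoint {suc k} fs)
extendDisjoint {k = zero} L f R u len f∈ =
  const f , refl , (λ _ → f∈) , λ { {zero} {zero} s≢t → contradiction refl s≢t }
extendDisjoint {n} {suc k} L f R u len f∈ =
  fs , refl , fs∈ , disj
  where
  R′ = List.tabulate f ++ R

  -- The `n` colours of `f` move from the budget `suc k * n` into `R′`, so the total is unchanged.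
  len′ : ∀ v → length R′ + k * n < length (L v)
  len′ v = ≤-<-trans (≤-reflexive (trans
    (cong (_+ k * n) (trans (List.length-++ (List.tabulate f)) (cong (_+ length R) (List.length-tabulate f))))
    (lem n (length R) (k * n)))) (len v)
    where
    lem : ∀ a b c → a + b + c ≡ b + (a + c)
    lem = solve-∀

  next : ∀ v → ∃[ c ] (c ∈ L v × c ∉ R′)
  next v = avoid R′ (u v) (≤-<-trans (m≤m+n _ _) (len′ v))

  rest = extendDisjoint {k = k} L (proj₁ ∘ next) R′ u len′ (proj₂ ∘ next)
  gs   = proj₁ rest
  gs∈  = proj₁ (proj₂ (proj₂ rest))

  fs : Fin (2 + k) → Fin n → Color
  fs zero    = f
  fs (suc t) = gs t

  fs∈ : ∀ t v → fs t v ∈ L v × fs t v ∉ R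
  fs∈ zero    v = f∈ v
  fs∈ (suc t) v = proj₁ (gs∈ t v) , λ ∈R → proj₂ (gs∈ t v) (∈-++⁺ʳ (List.tabulate f) ∈R)

  g∉f : ∀ t u v → f u ≢ gs t v
  g∉f t u v fu≡ = proj₂ (gs∈ t v) (∈-++⁺ˡ (subst (_∈ List.tabulate f) fu≡ (∈-tabulate⁺ u)))

  disj : Disjoint fs
  disj {zero}  {zero}  s≢t u v = contradiction refl s≢t
  disj {zero}  {suc t} s≢t u v = g∉f t u v
  disj {suc s} {zero}  s≢t u v = ≢-sym (g∉f s v u)
  disj {suc s} {suc t} s≢t u v = proj₂ (proj₂ (proj₂ rest)) (s≢t ∘ cong suc) u v

-- Granting requests part by part

requested : (Fin n → Maybe Color) → ℕ
requested r = # (is-just ∘ r)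

granted? : (Fin n → Maybe Color) → (Fin n → Color) → Fin n → Bool
granted? r f v = does (Maybe.≡-dec _≟_ (r v) (just (f v)))

granted : (Fin n → Maybe Color) → (Fin n → Color) → ℕ
granted r f = # (granted? r f)

granted-mono : (r r′ : Fin n → Maybe Color) (f f′ : Fin n → Color) →
  (∀ v → r v ≡ just (f v) → r′ v ≡ just (f′ v)) → granted r f ≤ granted r′ f′
granted-mono r r′ f f′ imp = #-mono λ v eq →
  dec-true (Maybe.≡-dec _≟_ (r′ v) (just (f′ v))) (imp v (does⁻ (Maybe.≡-dec _≟_ (r v) (just (f v))) eq))

restrict : List Color → Maybe Color → Maybe Color
restrict R nothing  = nothing
restrict R (just c) = if does (c ∈? R) then nothing else just c

restrict-just : ∀ R {x c} → restrict R x ≡ just c → x ≡ just c × c ∉ R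
restrict-just R {just d} eq with d ∈? R
restrict-just R {just d} refl | no d∉R = refl , d∉R

restrict-false : ∀ R {c} → is-just (restrict R (just c)) ≡ false → c ∈ R
restrict-false R {c} eq with c ∈? R
... | yes c∈R = c∈R

restrict-true : ∀ R {c} → c ∉ R → is-just (restrict R (just c)) ≡ true
restrict-true R {c} c∉R with c ∈? R
... | yes c∈R = contradiction c∈R c∉R
... | no  _   = refl

-- A colour lies in at most one of the k + 1 palettes, so each request survives at least k times.
requested-restrict : (fs : Fin (suc k) → Fin n → Color) → Disjoint fs → (r : Fin m → Maybe Color) →
  k * requested r ≤ ∑[ t < suc k ] requested (restrict (List.tabulate (fs t)) ∘ r)
requested-restrict {k} fs disj r = begin
  k * requested r                                ≡⟨ *-distribˡ-sum k (𝟙 ∘ is-just ∘ r) ⟩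
  ∑ (λ v → k * 𝟙 (is-just (r v)))                ≤⟨ ∑-mono-≤ (λ v → survive (r v)) ⟩
  ∑ (λ v → ∑ (λ t → 𝟙 (is-just (restrict (R t) (r v))))) ≡⟨ ∑-comm (λ v t → 𝟙 (is-just (restrict (R t) (r v)))) ⟩
  ∑ (λ t → requested (restrict (R t) ∘ r))       ∎
  where
  open ≤-Reasoning
  R = λ t → List.tabulate (fs t)

  survive : ∀ x → k * 𝟙 (is-just x) ≤ # (λ t → is-just (restrict (R t) x))
  survive nothing  = ≤-trans (≤-reflexive (*-zeroʳ k)) z≤n
  survive (just c) = ≤-trans (≤-reflexive (*-identityʳ k)) (#-all-but-one (λ t → is-just (restrict (R t) (just c))) once)
    where
    once : ∀ {s t} → s ≢ t → is-just (restrict (R s) (just c)) ≡ false →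
           is-just (restrict (R t) (just c)) ≡ true
    once {s} {t} s≢t ¬s = restrict-true (R t) λ c∈Rt →
      let u , c≡u = ∈-tabulate⁻ (restrict-false (R s) ¬s)
          v , c≡v = ∈-tabulate⁻ c∈Rt
      in disj s≢t u v (trans (sym c≡u) c≡v)

Sorted : Vec ℕ k → Set
Sorted ns = ∀ i j → i Fin.≤ j → lookup ns i ≤ lookup ns j

-- Applied with `n` the smallest part size, this turns the list-size bound into the budget that
-- `extendDisjoint` needs.
length*≤sum-init : ∀ {n} (ns : Vec ℕ (suc k)) → (∀ i → n ≤ lookup ns i) → k * n ≤ sum (init ns)
length*≤sum-init {zero}  _        n≤ = z≤n
length*≤sum-init {suc k} (_ ∷ ns) n≤ = +-mono-≤ (n≤ zero) (length*≤sum-init ns (n≤ ∘ suc))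

grantOrPick : ∀ {xs} (x : Maybe Color) → 0 < length xs → (∀ {c} → x ≡ just c → c ∈ xs) →
              ∃[ c ] (c ∈ xs × (is-just x ≡ true → x ≡ just c))
grantOrPick (just c) _ c∈ = c , c∈ refl , λ _ → refl
grantOrPick nothing  0< _ = let c , c∈ = pick 0< in c , c∈ , λ ()

Proper : (Fin n → Fin k) → (Fin n → Color) → Set
Proper p f = ∀ u v → p u ≢ p v → f u ≢ f v

-- `q` is the reciprocal of the fraction of requests granted. Lists need only be longer than `ℓ`,
-- and the request may be empty: deleting a palette leaves lists of varying lengths and may destroy
-- every request, and the induction must survive both.
Colorable : (Fin n → Fin k) → ℕ → ℕ → Set
Colorable {n} p q ℓ =
  ∀ (L : Fin n → List Color) → (∀ v → Unique (L v)) → (∀ v → ℓ < length (L v)) →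
  ∀ (r : Fin n → Maybe Color) → (∀ {v c} → r v ≡ just c → c ∈ L v) →
  ∃[ f ] (Proper p f × (∀ v → f v ∈ L v) ×
          requested r ≤ q * granted r f)

-- With a single part there are no edges, so every vertex takes its requested colour independently.
colorable-singlePart : (p : Fin n → Fin 1) → Colorable p 1 0
colorable-singlePart p L uniq len r r∈ =
  (λ v → proj₁ (c v)) , (λ u v → contradiction (same u v)) , (λ v → proj₁ (proj₂ (c v))) ,
  ≤-trans (#-mono λ v rv → dec-true (Maybe.≡-dec _≟_ _ _) (proj₂ (proj₂ (c v)) rv)) (m≤m+n _ _)
  where
  c = λ v → grantOrPick (r v) (len v) r∈

  same : ∀ u v → p u ≡ p v
  same u v with p u | p v
  ... | zero | zero = refl

-- This is the recursion step of `part`, so `part (n ∷ ns)` and `addPart n (part ns)` agree by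
-- computation.
addPart : ∀ n {m} → (Fin m → Fin k) → Fin (n + m) → Fin (suc k)
addPart n p v = [ const zero , suc ∘ p ]′ (splitAt n v)

glue : (Fin n → Color) → (Fin m → Color) → Fin (n + m) → Color
glue {n} e g v = [ e , g ]′ (splitAt n v)

module _ (e : Fin n → Color) (g : Fin m → Color) where

  glue-∈ : ∀ (L : Fin (n + m) → List Color) → (∀ i → e i ∈ L (i ↑ˡ m)) →
           (∀ j → g j ∈ L (n ↑ʳ j)) → ∀ v → glue e g v ∈ L v
  glue-∈ L e∈ g∈ v with splitAt n v in eq
  ... | inj₁ i = subst (λ w → e i ∈ L w) (Fin.splitAt⁻¹-↑ˡ eq) (e∈ i)
  ... | inj₂ j = subst (λ w → g j ∈ L w) (Fin.splitAt⁻¹-↑ʳ eq) (g∈ j)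

  glue-proper : (p : Fin m → Fin k) → (∀ i j → e i ≢ g j) → Proper p g →
                Proper (addPart n p) (glue e g)
  glue-proper p apart proper u v u~v with splitAt n u | splitAt n v
  ... | inj₁ _ | inj₁ _ = contradiction refl u~v
  ... | inj₁ i | inj₂ j = apart i j
  ... | inj₂ j | inj₁ i = ≢-sym (apart i j)
  ... | inj₂ i | inj₂ j = proper i j (u~v ∘ cong suc)

  glue-granted : ∀ r → granted (r ∘ (_↑ˡ m)) e + granted (r ∘ (n ↑ʳ_)) g ≤ granted r (glue e g)
  glue-granted r = begin
    granted (r ∘ (_↑ˡ m)) e + granted (r ∘ (n ↑ʳ_)) g
      ≤⟨ +-mono-≤
           (granted-mono (r ∘ (_↑ˡ m)) (r ∘ (_↑ˡ m)) e (glue e g ∘ (_↑ˡ m)) λ i eq →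
              trans eq (cong (just ∘ [ e , g ]′) (sym (Fin.splitAt-↑ˡ n i m))))
           (granted-mono (r ∘ (n ↑ʳ_)) (r ∘ (n ↑ʳ_)) g (glue e g ∘ (n ↑ʳ_)) λ j eq →
              trans eq (cong (just ∘ [ e , g ]′) (sym (Fin.splitAt-↑ʳ n m j)))) ⟩
    granted (r ∘ (_↑ˡ m)) (glue e g ∘ (_↑ˡ m)) + granted (r ∘ (n ↑ʳ_)) (glue e g ∘ (n ↑ʳ_))
      ≡⟨ ∑-splitAt n (𝟙 ∘ granted? r (glue e g)) ⟨
    granted r (glue e g) ∎
    where open ≤-Reasoning

-- The palette of `e` has at most `n` distinct colours, so deleting it leaves lists longer than `ℓ`
-- on the old parts. The old parts can then be coloured from these lists, granting a `q`-th of the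
-- surviving requests, without any clash with `e`.
extendPart : ∀ {n N k q ℓ} (p : Fin N → Fin k) → Colorable p q ℓ →
  (L : Fin (n + N) → List Color) → (∀ v → Unique (L v)) → (∀ v → n + ℓ < length (L v)) →
  (r : Fin (n + N) → Maybe Color) → (∀ {v c} → r v ≡ just c → c ∈ L v) →
  (e : Fin n → Color) → (∀ i → e i ∈ L (i ↑ˡ N)) →
  ∃[ f ] (Proper (addPart n p) f × (∀ v → f v ∈ L v) ×
          q * granted (r ∘ (_↑ˡ N)) e + requested (restrict (List.tabulate e) ∘ r ∘ (n ↑ʳ_)) ≤ q * granted r f)
extendPart {n} {N} {k} {q} {ℓ} p colorable L uniq len r r∈ e e∈ =
  extend (colorable L′ (λ v → ∖-unique R (uniq (n ↑ʳ v))) len′ r′ r′∈)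
  where
  open ≤-Reasoning
  Goal : Set
  Goal = ∃[ f ] (Proper (addPart n p) f × (∀ v → f v ∈ L v) ×
           q * granted (r ∘ (_↑ˡ N)) e + requested (restrict (List.tabulate e) ∘ r ∘ (n ↑ʳ_)) ≤ q * granted r f)

  R : List Color
  R = List.tabulate e

  L′ : Fin N → List Color
  L′ v = L (n ↑ʳ v) ∖ R

  r₁ : Fin n → Maybe Color
  r₁ i = r (i ↑ˡ N)

  r₂ r′ : Fin N → Maybe Color
  r₂ v = r (n ↑ʳ v)
  r′ v = restrict R (r₂ v)

  len′ : ∀ v → ℓ < length (L′ v)
  len′ v = +-cancelˡ-< n _ _ (begin-strict
    n + ℓ                    <⟨ len (n ↑ʳ v) ⟩
    length (L (n ↑ʳ v))      ≤⟨ length-∖ R (uniq (n ↑ʳ v)) ⟩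
    length R + length (L′ v) ≡⟨ cong (_+ length (L′ v)) (List.length-tabulate e) ⟩
    n + length (L′ v)        ∎)

  r′∈ : ∀ {v c} → r′ v ≡ just c → c ∈ L′ v
  r′∈ eq with restrict-just R eq
  ... | rv , c∉R = ∈-∖⁺ R (r∈ rv) c∉R

  extend : ∃[ g ] (Proper p g × (∀ v → g v ∈ L′ v) ×
                   requested r′ ≤ q * granted r′ g) → Goal
  extend (g , g-proper , g∈ , bound) =
    glue e g , glue-proper e g p apart g-proper , glue-∈ e g L e∈ (λ j → proj₁ (∈-∖⁻ R (g∈ j))) , (begin
      q * granted r₁ e + requested r′       ≤⟨ +-monoʳ-≤ (q * granted r₁ e) bound ⟩
      q * granted r₁ e + q * granted r′ g   ≡⟨ *-distribˡ-+ q (granted r₁ e) (granted r′ g) ⟨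
      q * (granted r₁ e + granted r′ g)
        -- A surviving request is an original one, so granting it in `r′` grants it in `r₂`.
        ≤⟨ *-monoʳ-≤ q (+-monoʳ-≤ (granted r₁ e)
             (granted-mono r′ r₂ g g λ j eq → proj₁ (restrict-just R eq))) ⟩
      q * (granted r₁ e + granted r₂ g)     ≤⟨ *-monoʳ-≤ q (glue-granted e g r) ⟩
      q * granted r (glue e g)              ∎)
    where
    apart : ∀ i j → e i ≢ g j
    apart i j eq = proj₂ (∈-∖⁻ R (g∈ j)) (subst (_∈ R) eq (∈-tabulate⁺ i))

-- The numerical hypothesis affords `suc k` colourings of the new part beyond the first, `2 + k` in
-- all. Each is extended to the old parts, and averaging their gains finds one that is good enough.
colorable-addPart : ∀ {n N k ℓ} (p : Fin N → Fin (suc k)) → suc k * n ≤ n + ℓ →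
  Colorable p (suc k) ℓ → Colorable (addPart n p) (2 + k) (n + ℓ)
colorable-addPart {n} {N} {k} {ℓ} p K*n≤ colorable L uniq len r r∈ =
  combine (extendDisjoint L₁ (λ i → proj₁ (c i)) [] (λ i → uniq (i ↑ˡ N))
    (λ i → ≤-<-trans K*n≤ (len (i ↑ˡ N))) (λ i → proj₁ (proj₂ (c i)) , λ ()))
  where
  open ≤-Reasoning
  K : ℕ
  K = suc k

  L₁ : Fin n → List Color
  L₁ i = L (i ↑ˡ N)

  r₁ : Fin n → Maybe Color
  r₁ i = r (i ↑ˡ N)

  r₂ : Fin N → Maybe Color
  r₂ v = r (n ↑ʳ v)

  c : ∀ i → ∃[ c ] (c ∈ L₁ i × (is-just (r₁ i) ≡ true → r₁ i ≡ just c))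
  c i = grantOrPick (r₁ i) (≤-<-trans z≤n (len (i ↑ˡ N))) r∈

  Goal : Set
  Goal = ∃[ f ] (Proper (addPart n p) f × (∀ v → f v ∈ L v) ×
                 requested r ≤ suc K * granted r f)

  gain : (Fin n → Color) → ℕ
  gain e = K * granted r₁ e + requested (restrict (List.tabulate e) ∘ r₂)

  finish : ∀ e → (∀ i → e i ∈ L₁ i) → K * requested r ≤ suc K * gain e → Goal
  finish e e∈ enough with extendPart {q = K} p colorable L uniq len r r∈ e e∈
  -- The average over `suc K` colourings and the weight `K` on the granted requests leave a common
  -- factor `K`, which is positive.
  ... | f , proper , f∈L , bound = f , proper , f∈L , *-cancelˡ-≤ K (begin
    K * requested r             ≤⟨ enough ⟩
    suc K * gain e              ≤⟨ *-monoʳ-≤ (suc K) bound ⟩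
    suc K * (K * granted r f)   ≡⟨ lem K (granted r f) ⟩
    K * (suc K * granted r f)   ∎)
    where
    lem : ∀ a b → suc a * (a * b) ≡ a * (suc a * b)
    lem = solve-∀

  combine : ∃[ fs ] (fs zero ≡ (λ i → proj₁ (c i)) × (∀ t i → fs t i ∈ L₁ i × fs t i ∉ []) ×
                     Disjoint {suc K} fs) → Goal
  combine (fs , fs₀≡ , fs∈ , disj) =
    let t , enough = averaging (gain ∘ fs) ∑gain in finish (fs t) (λ i → proj₁ (fs∈ t i)) enough
    where
    first : ∀ i → is-just (r₁ i) ≡ true → granted? r₁ (fs zero) i ≡ true
    first i eq = dec-true (Maybe.≡-dec _≟_ (r₁ i) (just (fs zero i)))
      (trans (proj₂ (proj₂ (c i)) eq) (cong just (sym (cong-app fs₀≡ i))))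

    ∑gain : K * requested r ≤ ∑ (gain ∘ fs)
    ∑gain = begin
      K * requested r
        ≡⟨ cong (K *_) (∑-splitAt n (𝟙 ∘ is-just ∘ r)) ⟩
      K * (requested r₁ + requested r₂)
        ≡⟨ *-distribˡ-+ K (requested r₁) (requested r₂) ⟩
      K * requested r₁ + K * requested r₂
        ≤⟨ +-mono-≤ (*-monoʳ-≤ K (#-mono {b = is-just ∘ r₁} {granted? r₁ (fs zero)} first))
                    (requested-restrict fs disj r₂) ⟩
      K * granted r₁ (fs zero) + ∑ (λ t → requested (restrict (List.tabulate (fs t)) ∘ r₂))
        -- Only the first colouring is known to grant the requests on the new part; whatever the
        -- others grant there just adds to the sum.
        ≤⟨ +-monoˡ-≤ _ (f[i]≤∑f (λ t → K * granted r₁ (fs t)) zero) ⟩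
      ∑ (λ t → K * granted r₁ (fs t)) + ∑ (λ t → requested (restrict (List.tabulate (fs t)) ∘ r₂))
        ≡⟨ ∑-distrib-+ (λ t → K * granted r₁ (fs t)) (λ t → requested (restrict (List.tabulate (fs t)) ∘ r₂)) ⟨
      ∑ (gain ∘ fs) ∎

-- Parts are peeled off smallest first, down to the largest one, which `init` drops; at each step
-- the peeled part is no larger than those that remain.
flexibleColoring : ∀ {k} (ns : Vec ℕ (suc k)) → Sorted ns → Colorable (part ns) (suc k) (sum (init ns))
flexibleColoring {zero}  ns@(_ ∷ [])  sorted = colorable-singlePart (part ns)
flexibleColoring {suc k} ns@(n ∷ ns′) sorted =
  colorable-addPart (part ns′) (length*≤sum-init ns (λ j → sorted zero j z≤n))
    (flexibleColoring ns′ (λ i j i≤j → sorted (suc i) (suc j) (s≤s i≤j)))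

-- Decidability of flexibility

-- Exhaustive search, one coordinate at a time. Choices are vectors, since a predicate on functions
-- need not respect pointwise equality.
∃-choice? : ∀ {A : Set} (xs : Fin n → List A) {P : Vec A n → Set} → Decidable P →
            Dec (∃[ ys ] ((∀ i → lookup ys i ∈ xs i) × P ys))
∃-choice? {zero}  xs P? = map′ (λ p → [] , (λ ()) , p) (λ { ([] , _ , p) → p }) (P? [])
∃-choice? {suc n} xs {P} P? = map′ to from (any? (λ x → ∃-choice? (xs ∘ suc) (P? ∘ (x ∷_))) (xs zero))
  where
  Tail : _ → Set
  Tail x = ∃[ ys ] ((∀ i → lookup ys i ∈ xs (suc i)) × P (x ∷ ys))

  to : Any Tail (xs zero) → ∃[ ys ] ((∀ i → lookup ys i ∈ xs i) × P ys)
  to any with find any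
  ... | x , x∈ , ys , ys∈ , p = x ∷ ys , (λ { zero → x∈ ; (suc i) → ys∈ i }) , p

  from : ∃[ ys ] ((∀ i → lookup ys i ∈ xs i) × P ys) → Any Tail (xs zero)
  from (x ∷ ys , ∈xs , p) = lose (∈xs zero) (ys , ∈xs ∘ suc , p)

∀-choice? : ∀ {A : Set} (xs : Fin n → List A) {P : Vec A n → Set} → Decidable P →
            Dec (∀ ys → (∀ i → lookup ys i ∈ xs i) → P ys)
∀-choice? xs P? = map′
  (λ ¬∃ ys ys∈ → decidable-stable (P? ys) (λ ¬p → ¬∃ (ys , ys∈ , ¬p)))
  (λ ∀P (ys , ys∈ , ¬p) → ¬p (∀P ys ys∈))
  (¬? (∃-choice? xs (¬? ∘ P?)))

words : List Color → ℕ → List (List Color)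
words cs zero    = [] ∷ []
words cs (suc k) = List.cartesianProductWith _∷_ cs (words cs k)

∈-words : ∀ {cs xs} → length xs ≡ k → (∀ {x} → x ∈ xs → x ∈ cs) → xs ∈ words cs k
∈-words {xs = []}     refl xs⊆cs = here refl
∈-words {xs = x ∷ xs} refl xs⊆cs =
  ∈-cartesianProductWith⁺ _∷_ (xs⊆cs (here refl)) (∈-words refl (xs⊆cs ∘ there))

module _ (xs : List Color) where

  -- Colours outside xs are moved above length xs to make the renaming injective everywhere.
  rename : Color → Color
  rename c with c ∈? xs
  ... | yes c∈xs = toℕ (Any.index c∈xs)
  ... | no  _    = length xs + c

  rename-< : ∀ {c} → c ∈ xs → rename c < length xs
  rename-< {c} c∈ with c ∈? xs
  ... | yes c∈xs = Fin.toℕ<n (Any.index c∈xs)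
  ... | no  c∉xs = contradiction c∈ c∉xs

  rename-injective : ∀ {c d} → rename c ≡ rename d → c ≡ d
  rename-injective {c} {d} eq with c ∈? xs | d ∈? xs
  ... | yes c∈ | yes d∈ = Membershipₛ.index-injective (setoid Color) c∈ d∈ (Fin.toℕ-injective eq)
  ... | yes c∈ | no  _  = contradiction eq (<⇒≢ (<-≤-trans (Fin.toℕ<n (Any.index c∈)) (m≤m+n _ _)))
  ... | no  _  | yes d∈ = contradiction (sym eq) (<⇒≢ (<-≤-trans (Fin.toℕ<n (Any.index d∈)) (m≤m+n _ _)))
  ... | no  _  | no  _  = +-cancelˡ-≡ (length xs) c d eq

-- Counts the colours of all lists with repetition, which bounds the values that the renaming takes
-- on them.
length-concat-tabulate : (L : Fin n → List Color) → (∀ v → length (L v) ≡ k) →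
                         length (List.concat (List.tabulate L)) ≡ n * k
length-concat-tabulate {zero}  L len = refl
length-concat-tabulate {suc n} L len =
  trans (List.length-++ (L zero)) (cong₂ _+_ (len zero) (length-concat-tabulate (L ∘ suc) (len ∘ suc)))

justs-∈? : ∀ x (cs : List Color) → Dec (∀ {c} → x ≡ just c → c ∈ cs)
justs-∈? nothing  cs = yes λ ()
justs-∈? (just c) cs = map′ (λ { c∈ refl → c∈ }) (λ p → p refl) (c ∈? cs)

fromℚᵘ-mono-≤ : ∀ {p q} → p ℚᵘ.≤ q → ℚ.fromℚᵘ p ℚ.≤ ℚ.fromℚᵘ q
fromℚᵘ-mono-≤ {p} {q} p≤q = ℚ.toℚᵘ-cancel-≤ (begin
  ℚ.toℚᵘ (ℚ.fromℚᵘ p) ≃⟨ ℚ.toℚᵘ-fromℚᵘ p ⟩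
  p                   ≤⟨ p≤q ⟩
  q                   ≃⟨ ℚ.toℚᵘ-fromℚᵘ q ⟨
  ℚ.toℚᵘ (ℚ.fromℚᵘ q) ∎)
  where open ℚᵘ.≤-Reasoning

-- Cross-multiplication, carried out on unnormalised fractions, where it is the definition of the
-- order.
/-mono-≤ : ∀ a b c d → a * suc d ≤ c * suc b → + a ℚ./ suc b ℚ.≤ + c ℚ./ suc d
/-mono-≤ a b c d le = fromℚᵘ-mono-≤ {mkℚᵘ (+ a) b} {mkℚᵘ (+ c) d}
  (ℚᵘ.*≤* (subst₂ ℤ._≤_ (ℤ.pos-* a (suc d)) (ℤ.pos-* c (suc b)) (ℤ.+≤+ le)))

module _ (G : Graph) (ε : ℚ) where
  open Graph G using (order; Vertex; _~_; _~?_)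

  Satisfies : ListAssignment G → PartialColoring G → (Vertex → Color) → Set
  Satisfies L r f = IsProperListColoring G L f ×
                    ε ℚ.* (+ ∣ domain G r ∣ ℚ./ 1) ℚ.≤ + ∣ satisfied G r f ∣ ℚ./ 1

  satisfies? : ∀ L r f → Dec (Satisfies L r f)
  satisfies? L r f =
    (map′ (λ p {u} {v} → p u v) (λ p u v → p) (Fin.all? λ u → Fin.all? λ v → (u ~? v) →-dec ¬? (f u ≟ f v))
     ×-dec Fin.all? λ v → f v ∈? L v)
    ×-dec (_ ℚ.≤? _)

  -- Serves both to replace a colouring by its table of values and to undo a renaming of colours.
  -- Properness passes over because `f′` identifies no more vertices than `f` does.
  satisfies-transfer : ∀ {L L′ r r′ f f′} → Satisfies L r f →
    (∀ v → f′ v ∈ L′ v) → (∀ u v → f′ u ≡ f′ v → f u ≡ f v) →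
    (∀ v → is-just (r′ v) ≡ is-just (r v)) → (∀ v → r v ≡ just (f v) → r′ v ≡ just (f′ v)) →
    Satisfies L′ r′ f′
  satisfies-transfer {r = r} {r′} {f} {f′} ((proper , _) , bound) f′∈ f′≡⇒f≡ same-domain granted⇒ =
    ((λ {u} {v} u~v → proper u~v ∘ f′≡⇒f≡ u v) , f′∈) , (begin
      ε ℚ.* (+ ∣ domain G r′ ∣ ℚ./ 1) ≡⟨ cong (λ s → ε ℚ.* (+ ∣ s ∣ ℚ./ 1)) (Vec.tabulate-cong same-domain) ⟩
      ε ℚ.* (+ ∣ domain G r ∣ ℚ./ 1)  ≤⟨ bound ⟩
      + ∣ satisfied G r f ∣ ℚ./ 1
        ≤⟨ /-mono-≤ (∣ satisfied G r f ∣) 0 (∣ satisfied G r′ f′ ∣) 0 (*-monoˡ-≤ 1 satisfied≤) ⟩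
      + ∣ satisfied G r′ f′ ∣ ℚ./ 1   ∎)
    where
    open ℚ.≤-Reasoning
    satisfied≤ : ∣ satisfied G r f ∣ ≤ ∣ satisfied G r′ f′ ∣
    satisfied≤ = subst₂ _≤_ (sym (∣tabulate∣ (granted? r f))) (sym (∣tabulate∣ (granted? r′ f′)))
                            (granted-mono r r′ f f′ granted⇒)

  satisfiable? : ∀ L r → Dec (Satisfiable G L r ε)
  satisfiable? L r = map′
    (λ (fs , _ , s) → lookup fs , s)
    (λ (f , s@((_ , f∈) , _)) → tabulate f ,
       (λ v → subst (_∈ L v) (sym (Vec.lookup∘tabulate f v)) (f∈ v)) ,
       satisfies-transfer s
         (λ v → subst (_∈ L v) (sym (Vec.lookup∘tabulate f v)) (f∈ v))
         (λ u v eq → trans (sym (Vec.lookup∘tabulate f u)) (trans eq (Vec.lookup∘tabulate f v)))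
         (λ _ → refl)
         (λ v eq → trans eq (cong just (sym (Vec.lookup∘tabulate f v)))))
    (∃-choice? L (λ fs → satisfies? L r (lookup fs)))

  module _ (k : ℕ) where

    palette : List Color
    palette = List.upTo (order * k)

    requestValues : List (Maybe Color)
    requestValues = nothing ∷ List.map just palette

    isAssignment? : ∀ L → Dec (IsAssignment G k L)
    isAssignment? L = Fin.all? λ v → unique? (L v) ×-dec (length (L v) ≟ k)

    isRequest? : ∀ L r → Dec (IsRequest G L r)
    isRequest? L r = Subset.nonempty? (domain G r) ×-dec
      map′ (λ p {v} {c} → p v {c}) (λ p v {c} → p {v} {c}) (Fin.all? λ v → justs-∈? (r v) (L v))

    -- `words` also produces lists with repeated colours, so being a `k`-assignment remains a
    -- separate condition.
    FiniteFlexible : Set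
    FiniteFlexible =
      ∀ Ls → (∀ v → lookup Ls v ∈ words palette k) → IsAssignment G k (lookup Ls) →
      ∀ rs → (∀ v → lookup rs v ∈ requestValues) → IsRequest G (lookup Ls) (lookup rs) →
      Satisfiable G (lookup Ls) (lookup rs) ε

    finiteFlexible? : Dec FiniteFlexible
    finiteFlexible? = ∀-choice? (const (words palette k)) λ Ls →
      isAssignment? (lookup Ls) →-dec ∀-choice? (const requestValues) λ rs →
      isRequest? (lookup Ls) (lookup rs) →-dec satisfiable? (lookup Ls) (lookup rs)

    -- At most `order * k` colours occur in the lists, so they can be renamed injectively into
    -- `palette`; a colouring found there is pulled back.
    finiteFlexible⇒flexible : FiniteFlexible → Flexible G k ε
    finiteFlexible⇒flexible flexible L isL r (dom , r∈) = unrename (flexible Ls Ls∈ isLs rs rs∈ isRs)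
      where
      U : List Color
      U = List.concat (List.tabulate L)

      ∈U : ∀ {v c} → c ∈ L v → c ∈ U
      ∈U {v} c∈ = ∈-concat⁺′ c∈ (∈-tabulate⁺ v)

      rename-∈ : ∀ {c} → c ∈ U → rename U c ∈ palette
      rename-∈ {c} c∈ = ∈-upTo⁺ (subst (rename U c <_) (length-concat-tabulate L (proj₂ ∘ isL)) (rename-< U c∈))

      L′ : Vertex → List Color
      L′ = List.map (rename U) ∘ L

      r′ : Vertex → Maybe Color
      r′ = Maybe.map (rename U) ∘ r

      Ls = tabulate L′
      rs = tabulate r′

      lookupL : ∀ v → lookup Ls v ≡ L′ v
      lookupL = Vec.lookup∘tabulate L′

      lookupr : ∀ v → lookup rs v ≡ r′ v
      lookupr = Vec.lookup∘tabulate r′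

      Ls∈ : ∀ v → lookup Ls v ∈ words palette k
      Ls∈ v = subst (_∈ words palette k) (sym (lookupL v))
        (∈-words (trans (List.length-map (rename U) (L v)) (proj₂ (isL v)))
          λ c′∈ → let c , c∈ , eq = ∈-map⁻ (rename U) c′∈ in
                  subst (_∈ palette) (sym eq) (rename-∈ (∈U c∈)))

      isLs : IsAssignment G k (lookup Ls)
      isLs v = subst (λ xs → Unique xs × length xs ≡ k) (sym (lookupL v))
        (Unique.map⁺ (rename-injective U) (proj₁ (isL v)) , trans (List.length-map (rename U) (L v)) (proj₂ (isL v)))

      rs∈ : ∀ v → lookup rs v ∈ requestValues
      rs∈ v = subst (_∈ requestValues) (sym (lookupr v)) (value (r v) (λ rv → rename-∈ (∈U (r∈ rv))))
        where
        value : ∀ x → (∀ {c} → x ≡ just c → rename U c ∈ palette) → Maybe.map (rename U) x ∈ requestValues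
        value nothing  _  = here refl
        value (just c) c∈ = there (∈-map⁺ just (c∈ refl))

      is-just-rs : ∀ v → is-just (r v) ≡ is-just (lookup rs v)
      is-just-rs v = trans (sym (is-just-map (r v))) (cong is-just (sym (lookupr v)))
        where
        is-just-map : ∀ x → is-just (Maybe.map (rename U) x) ≡ is-just x
        is-just-map nothing  = refl
        is-just-map (just _) = refl

      isRs : IsRequest G (lookup Ls) (lookup rs)
      isRs = subst Nonempty (Vec.tabulate-cong is-just-rs) dom , λ {v} {c} eq →
        subst (c ∈_) (sym (lookupL v)) (value∈ v (r v) r∈ (trans (sym (lookupr v)) eq))
        where
        value∈ : ∀ v x {c} → (∀ {d} → x ≡ just d → d ∈ L v) → Maybe.map (rename U) x ≡ just c → c ∈ L′ v
        value∈ v (just d) d∈ refl = ∈-map⁺ (rename U) (d∈ refl)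

      unrename : Satisfiable G (lookup Ls) (lookup rs) ε → Satisfiable G L r ε
      unrename (f′ , s@((_ , f′∈) , _)) = f , satisfies-transfer s (λ v → proj₁ (proj₂ (origin v)))
          (λ u v eq → trans (f′≡ u) (trans (cong (rename U) eq) (sym (f′≡ v))))
          is-just-rs granted⇒
        where
        -- The colour of `v` lies in the renamed list, so its preimage can be chosen inside `L v`.
        origin : ∀ v → ∃[ c ] (c ∈ L v × f′ v ≡ rename U c)
        origin v = ∈-map⁻ (rename U) (subst (f′ v ∈_) (lookupL v) (f′∈ v))
        f   = λ v → proj₁ (origin v)
        f′≡ = λ v → proj₂ (proj₂ (origin v))

        granted⇒ : ∀ v → lookup rs v ≡ just (f′ v) → r v ≡ just (f v)
        granted⇒ v eq = Maybe.map-injective (rename-injective U)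
          (trans (sym (lookupr v)) (trans eq (cong just (f′≡ v))))

    flexible? : Dec (Flexible G k ε)
    flexible? = map′ finiteFlexible⇒flexible
      (λ flexible Ls _ isLs rs _ isRs → flexible (lookup Ls) isLs (lookup rs) isRs)
      finiteFlexible?

-- Decidability allows a search below `m`: either a smaller witness takes over, or `m` itself is
-- least.
least : ∀ {P : ℕ → Set} → Decidable P → ∀ m → P m → ∃[ l ] (IsLeast _≤_ P l × l ≤ m)
least {P} P? = <-rec _ step
  where
  step : ∀ m → (∀ {i} → i < m → P i → ∃[ l ] (IsLeast _≤_ P l × l ≤ i)) →
         P m → ∃[ l ] (IsLeast _≤_ P l × l ≤ m)
  step m rec pm with anyUpTo? P? m
  ... | yes (i , i<m , pi) = let l , isLeast , l≤i = rec i<m pi in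
                             l , isLeast , ≤-trans l≤i (<⇒≤ i<m)
  ... | no ¬below          = m , (pm , λ x px → ≮⇒≥ (λ x<m → ¬below (x , x<m , px))) , ≤-refl

-- The Hall ratio

∈ₛ-tabulate⁺ : ∀ (b : Fin n → Bool) {i} → b i ≡ true → i Subset.∈ tabulate b
∈ₛ-tabulate⁺ b {i} bi = Vec.lookup⇒[]= i (tabulate b) (trans (Vec.lookup∘tabulate b i) bi)

∈ₛ-tabulate⁻ : ∀ (b : Fin n → Bool) {i} → i Subset.∈ tabulate b → b i ≡ true
∈ₛ-tabulate⁻ b {i} i∈ = trans (sym (Vec.lookup∘tabulate b i)) (Vec.[]=⇒lookup i∈)

#-false : ∀ n → # {n} (const false) ≡ 0
#-false n = trans (∑-const n 0) (*-zeroʳ n)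

#-≟ : (x : Fin n) → # (λ i → does (x Fin.≟ i)) ≡ 1
#-≟ {suc n} zero    = cong suc (#-false n)
#-≟ {suc n} (suc x) = #-≟ x

#-fibres : (p : Fin n → Fin k) (b : Fin n → Bool) →
           # b ≡ ∑[ i < k ] # (λ v → b v ∧ does (p v Fin.≟ i))
#-fibres {k = k} p b = trans (sum-cong-≗ (λ v → sym (fibre (b v) (p v))))
  (∑-comm (λ v i → 𝟙 (b v ∧ does (p v Fin.≟ i))))
  where
  fibre : ∀ c x → # (λ i → c ∧ does (x Fin.≟ i)) ≡ 𝟙 c
  fibre true  x = #-≟ x
  fibre false x = #-false k

#-fibres-≤ : ∀ {n k c} (p : Fin n → Fin k) (b : Fin n → Bool) →
  (∀ i → ∣ tabulate (λ v → b v ∧ does (p v Fin.≟ i)) ∣ ≤ c) → # b ≤ k * c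
#-fibres-≤ {k = k} {c} p b fibre≤ = begin
  # b                         ≡⟨ #-fibres p b ⟩
  ∑[ i < k ] # (fibre i)      ≤⟨ ∑-mono-≤ (λ i → ≤-trans (≤-reflexive (sym (∣tabulate∣ (fibre i)))) (fibre≤ i)) ⟩
  ∑ {k} (const c)             ≡⟨ ∑-const k c ⟩
  k * c                       ∎
  where
  open ≤-Reasoning
  fibre = λ i v → b v ∧ does (p v Fin.≟ i)

part-surjective : (ns : Vec ℕ k) → (∀ i → 1 ≤ lookup ns i) → ∀ i → ∃[ v ] part ns v ≡ i
part-surjective (n ∷ ns) pos zero =
  Fin.fromℕ< (pos zero) ↑ˡ sum ns ,
  cong [ const zero , suc ∘ part ns ]′ (Fin.splitAt-↑ˡ n (Fin.fromℕ< (pos zero)) (sum ns))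
part-surjective (n ∷ ns) pos (suc i) =
  let v , pv≡i = part-surjective ns (pos ∘ suc) i in
  n ↑ʳ v , trans (cong [ const zero , suc ∘ part ns ]′ (Fin.splitAt-↑ʳ n (sum ns) v)) (cong suc pv≡i)

module _ {k} (n₁ : ℕ) (ns′ : Vec ℕ k) (pos : ∀ i → 1 ≤ lookup (n₁ ∷ ns′) i) where

  private
    ns = n₁ ∷ ns′
    G  = completeMultipartite ns pos
    p  = part ns

  open Graph G using (order; Vertex; _~_; _~?_)

  -- The vertices of `H` in one part are pairwise nonadjacent in `G`, hence in `H`, so each of the
  -- `suc k` fibres has at most `a` elements.
  order≤parts*α : (H : Subgraph G) → ∀ {a} → IsIndependenceNumber H a →
                  ∣ Subgraph.vertices H ∣ ≤ suc k * a
  order≤parts*α H {a} (_ , α-max) = begin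
    ∣ V ∣                       ≡⟨ cong ∣_∣ (Vec.tabulate∘lookup V) ⟨
    ∣ tabulate (lookup V) ∣     ≡⟨ ∣tabulate∣ (lookup V) ⟩
    # (lookup V)                ≤⟨ #-fibres-≤ p (lookup V) (λ i → α-max _ (fibre i , independent i , refl)) ⟩
    suc k * a                   ∎
    where
    open ≤-Reasoning
    open Subgraph H using (~ₕ⇒~) renaming (vertices to V)

    fibre : Fin (suc k) → Subset order
    fibre i = tabulate (λ v → lookup V v ∧ does (p v Fin.≟ i))

    ∈-fibre : ∀ {i v} → v Subset.∈ fibre i → v Subset.∈ V × p v ≡ i
    ∈-fibre {i} {v} v∈ with lookup V v in Vv | ∈ₛ-tabulate⁻ (λ v → lookup V v ∧ does (p v Fin.≟ i)) v∈
    ... | true | pv≡i = Vec.lookup⇒[]= v V Vv , does⁻ (p v Fin.≟ i) pv≡i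

    independent : ∀ i → Independent H (fibre i)
    independent i = proj₁ ∘ ∈-fibre , λ u∈ v∈ u~v →
      ~ₕ⇒~ u~v (trans (proj₂ (∈-fibre u∈)) (sym (proj₂ (∈-fibre v∈))))

  rep : Fin (suc k) → Vertex
  rep i = proj₁ (part-surjective ns pos i)

  part-rep : ∀ i → p (rep i) ≡ i
  part-rep i = proj₂ (part-surjective ns pos i)

  -- The image of `rep`, written as a test on each vertex against the representative of its own
  -- part.
  isRep : Vertex → Bool
  isRep v = does (v Fin.≟ rep (p v))

  transversal : Subset order
  transversal = tabulate isRep

  rep∈ : ∀ i → rep i Subset.∈ transversal
  rep∈ i = ∈ₛ-tabulate⁺ isRep (dec-true (_ Fin.≟ _) (cong rep (sym (part-rep i))))

  ∣transversal∣ : ∣ transversal ∣ ≡ suc k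
  ∣transversal∣ = begin
    ∣ transversal ∣                                               ≡⟨ ∣tabulate∣ isRep ⟩
    # isRep                                                       ≡⟨ #-fibres p isRep ⟩
    -- The transversal meets part `i` in `rep i` alone.
    ∑[ i < suc k ] # (λ v → isRep v ∧ does (p v Fin.≟ i))         ≡⟨ sum-cong-≗ (λ i → sum-cong-≗ (λ v → cong 𝟙 (single i v))) ⟩
    ∑[ i < suc k ] # (λ v → does (rep i Fin.≟ v))                 ≡⟨ sum-cong-≗ (λ i → #-≟ (rep i)) ⟩
    ∑ {suc k} (const 1)                                           ≡⟨ ∑-const (suc k) 1 ⟩
    suc k * 1                                                     ≡⟨ *-identityʳ (suc k) ⟩
    suc k                                                         ∎
    where
    open ≡-Reasoning
    single : ∀ i v → isRep v ∧ does (p v Fin.≟ i) ≡ does (rep i Fin.≟ v)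
    single i v = does-⇔ (mk⇔ (λ { (v≡ , refl) → sym v≡ })
                             (λ { refl → cong rep (sym (part-rep i)) , part-rep i }))
                        ((v Fin.≟ rep (p v)) ×-dec (p v Fin.≟ i)) (rep i Fin.≟ v)

  clique : Subgraph G
  clique = record
    { vertices = transversal
    ; nonempty = rep zero , rep∈ zero
    ; _~ₕ_     = λ u v → u ~ v × u Subset.∈ transversal × v Subset.∈ transversal
    ; _~ₕ?_    = λ u v → (u ~? v) ×-dec ((u Subset.∈? transversal) ×-dec (v Subset.∈? transversal))
    ; ~ₕ-sym   = λ (u~v , u∈ , v∈) → ≢-sym u~v , v∈ , u∈
    ; ~ₕ⇒~     = proj₁
    ; ~ₕ⇒∈     = proj₂
    }

  clique-α : IsIndependenceNumber clique 1
  clique-α = (⁅ rep zero ⁆ , (⊆transversal , single) , Subset.∣⁅x⁆∣≡1 (rep zero)) ,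
             λ { _ (S , indep , refl) → α≤1 S indep }
    where
    ⊆transversal : ⁅ rep zero ⁆ Subset.⊆ transversal
    ⊆transversal x∈ = subst (Subset._∈ transversal) (sym (Subset.x∈⁅y⁆⇒x≡y _ x∈)) (rep∈ zero)

    single : ∀ {u v} → u Subset.∈ ⁅ rep zero ⁆ → v Subset.∈ ⁅ rep zero ⁆ →
             ¬ (u ~ v × u Subset.∈ transversal × v Subset.∈ transversal)
    single u∈ v∈ (u~v , _) = u~v (cong p (trans (Subset.x∈⁅y⁆⇒x≡y _ u∈) (sym (Subset.x∈⁅y⁆⇒x≡y _ v∈))))

    α≤1 : ∀ S → Independent clique S → ∣ S ∣ ≤ 1
    α≤1 S (S⊆ , indep) with Subset.nonempty? S
    ... | no  empty    rewrite Subset.Empty-unique empty | Subset.∣⊥∣≡0 order = z≤n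
    ... | yes (x , x∈) = ≤-trans (Subset.p⊆q⇒∣p∣≤∣q∣ S⊆⁅x⁆) (≤-reflexive (Subset.∣⁅x⁆∣≡1 x))
      where
      v≡rep : ∀ {v} → v Subset.∈ S → v ≡ rep (p v)
      v≡rep {v} v∈ = does⁻ (v Fin.≟ rep (p v)) (∈ₛ-tabulate⁻ isRep (S⊆ v∈))

      -- Two members of `S` in different parts would be adjacent; in the same part they are both its
      -- representative.
      S⊆⁅x⁆ : S Subset.⊆ ⁅ x ⁆
      S⊆⁅x⁆ {y} y∈ with p y Fin.≟ p x
      ... | no  y~x = contradiction (y~x , S⊆ y∈ , S⊆ x∈) (indep y∈ x∈)
      ... | yes py≡px = subst (Subset._∈ ⁅ x ⁆)
              (trans (v≡rep x∈) (trans (cong rep (sym py≡px)) (sym (v≡rep y∈)))) (Subset.x∈⁅x⁆ x)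

  hallRatio : IsHallRatio G (+ suc k ℚ./ 1)
  hallRatio =
    -- The `0` encodes independence number 1, as the denominator is `suc a`.
    (clique , 0 , clique-α , cong (λ s → + s ℚ./ 1) (sym ∣transversal∣)) ,
    λ { q (H , a , α , refl) → /-mono-≤ (∣ Subgraph.vertices H ∣) a (suc k) 0
          (≤-trans (≤-reflexive (*-identityʳ _)) (order≤parts*α H α)) }

-- The counting bound in rational form, and the theorem.

/1-homo-* : ∀ a b → + (a * b) ℚ./ 1 ≡ (+ a ℚ./ 1) ℚ.* (+ b ℚ./ 1)
/1-homo-* a b = ℚ.toℚᵘ-injective (begin
  ℚ.toℚᵘ (+ (a * b) ℚ./ 1)                      ≈⟨ ℚ.toℚᵘ-fromℚᵘ (mkℚᵘ (+ (a * b)) 0) ⟩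
  mkℚᵘ (+ (a * b)) 0                            ≡⟨ cong (λ i → mkℚᵘ i 0) (ℤ.pos-* a b) ⟩
  mkℚᵘ (+ a) 0 ℚᵘ.* mkℚᵘ (+ b) 0
    ≈⟨ ℚᵘ.*-cong (ℚ.toℚᵘ-fromℚᵘ (mkℚᵘ (+ a) 0)) (ℚ.toℚᵘ-fromℚᵘ (mkℚᵘ (+ b) 0)) ⟨
  ℚ.toℚᵘ (+ a ℚ./ 1) ℚᵘ.* ℚ.toℚᵘ (+ b ℚ./ 1)    ≈⟨ ℚ.toℚᵘ-homo-* (+ a ℚ./ 1) (+ b ℚ./ 1) ⟨
  ℚ.toℚᵘ ((+ a ℚ./ 1) ℚ.* (+ b ℚ./ 1))          ∎)
  where open import Relation.Binary.Reasoning.Setoid ℚᵘ.≃-setoid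

-- The integer bound says `a ≤ ρ b`; multiplying by the positive number `ρ⁻¹` gives the form used in
-- `Satisfiable`.
ρ⁻¹*a≤b : ∀ k a b (ρ≢0 : ℚ.NonZero (+ suc k ℚ./ 1)) → a ≤ suc k * b →
  (1/ (+ suc k ℚ./ 1)) {{ρ≢0}} ℚ.* (+ a ℚ./ 1) ℚ.≤ + b ℚ./ 1
ρ⁻¹*a≤b k a b ρ≢0 a≤ = begin
  ρ⁻¹ ℚ.* (+ a ℚ./ 1)             ≤⟨ ℚ.*-monoˡ-≤-nonNeg ρ⁻¹ {{ℚ.pos⇒nonNeg ρ⁻¹ {{ℚ.1/pos⇒pos ρ {{ρ-pos}}}}}} a≤ρb ⟩
  ρ⁻¹ ℚ.* (ρ ℚ.* (+ b ℚ./ 1))     ≡⟨ ℚ.*-assoc ρ⁻¹ ρ _ ⟨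
  (ρ⁻¹ ℚ.* ρ) ℚ.* (+ b ℚ./ 1)     ≡⟨ cong (ℚ._* (+ b ℚ./ 1)) (ℚ.*-inverseˡ ρ {{ρ≢0}}) ⟩
  ℚ.1ℚ ℚ.* (+ b ℚ./ 1)            ≡⟨ ℚ.*-identityˡ _ ⟩
  + b ℚ./ 1                       ∎
  where
  open ℚ.≤-Reasoning
  ρ = + suc k ℚ./ 1
  ρ⁻¹ = (1/ ρ) {{ρ≢0}}

  ρ-pos : ℚ.Positive ρ
  ρ-pos = ℚ.normalize-pos (suc k) 1

  a≤ρb : + a ℚ./ 1 ℚ.≤ ρ ℚ.* (+ b ℚ./ 1)
  a≤ρb = ℚ.≤-trans (/-mono-≤ a 0 (suc k * b) 0 (*-monoˡ-≤ 1 a≤)) (ℚ.≤-reflexive (/1-homo-* (suc k) b))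

flexible-parts : ∀ {k} (n₁ : ℕ) (ns : Vec ℕ k) pos → Sorted (n₁ ∷ ns) → (ρ≢0 : ℚ.NonZero (+ suc k ℚ./ 1)) →
  Flexible (completeMultipartite (n₁ ∷ ns) pos) (sum (init (n₁ ∷ ns)) + 1) ((1/ (+ suc k ℚ./ 1)) {{ρ≢0}})
flexible-parts {k} n₁ ns pos sorted ρ≢0 L isL r (_ , r∈) =
  let f , proper , f∈L , bound = flexibleColoring (n₁ ∷ ns) sorted L (proj₁ ∘ isL)
        -- The extra colour in each list supplies the strict inequality required by `Colorable`.
        (λ v → ≤-reflexive (trans (+-comm 1 _) (sym (proj₂ (isL v))))) r r∈
  in f , ((λ {u} {v} → proper u v) , f∈L) ,
     ρ⁻¹*a≤b k _ _ ρ≢0 (subst₂ (λ a b → a ≤ suc k * b)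
       (sym (∣tabulate∣ (is-just ∘ r))) (sym (∣tabulate∣ (granted? r f))) bound)

theorem6 : ∀ (j : ℕ) (ns : Vec ℕ (2 + j)) (pos : ∀ i → 1 ≤ lookup ns i) →
    (∀ i j → i Fin.≤ j → lookup ns i ≤ lookup ns j) →
    ∃[ χ ] (IsListFlexibilityNumber (completeMultipartite ns pos) χ × χ ≤ sum (init ns) + 1)
theorem6 j ns@(n₁ ∷ ns′) pos sorted =
  -- The search for the least `k` starts from the known witness `sum (init ns) + 1`, so its result
  -- is bounded by it.
  let χ , isLeast , χ≤ = least (λ k → (1 ≤? k) ×-dec flexible? (completeMultipartite ns pos) ρ⁻¹ k)
        (sum (init ns) + 1) (m≤n+m 1 _ , flexible-parts n₁ ns′ pos sorted ρ≢0)
  in χ , (ρ , ρ≢0 , hallRatio n₁ ns′ pos , isLeast) , χ≤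
  where
  ρ : ℚ
  ρ = + (2 + j) ℚ./ 1

  ρ≢0 : ℚ.NonZero ρ
  ρ≢0 = ℚ.pos⇒nonZero ρ {{ℚ.normalize-pos (2 + j) 1}}

  ρ⁻¹ : ℚ
  ρ⁻¹ = (1/ ρ) {{ρ≢0}}
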